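{- Let $G$ be a finite connected graph of order at least $4$. Then $$\operatorname{sdiam}_4(G)\leq \frac{10}{7}\,\operatorname{srad}_4(G).$$
   Context: Graphs are finite, simple and undirected. The order of a graph is its number of vertices, and its size is its number of edges. For a connected graph $G$ and a non-empty set $S\subseteq V(G)$, the Steiner distance $d(S)$ is the minimum size (number of edges) of a connected subgraph of $G$ containing all vertices of $S$. For an integer $k$ with $2\le k\le |V(G)|$ and $v\in V(G)$, the Steiner $k$-eccentricity of $v$ is $\operatorname{e}_k(v)=\max\{d(S): S\subseteq V(G),\ |S|=k,\ v\in S\}$. The Steiner $k$-radius is $\operatorname{srad}_k(G)=\min\{\operatorname{e}_k(v):v\in V(G)\}$ and the Steiner $k$-diameter is $\operatorname{sdiam}_k(G)=\max\{\operatorname{e}_k(v):v\in V(G)\}$. -}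

module Defs where

open import Level using (Level; 0ℓ; suc)
open import Data.Nat.Base using (ℕ; _≤_)
open import Data.Fin.Base using (Fin; _<_)
open import Data.Fin.Properties using (_<?_)
open import Data.Fin.Subset using (Subset; _∈_; _⊆_; ∣_∣)
open import Data.List.Base using (length; filter; allFin; cartesianProduct)
open import Data.Product.Base using (_×_; _,_; ∃)
open import Relation.Binary.Core using (Rel; _⇒_)
open import Relation.Binary.Definitions using (Decidable; Symmetric; Irreflexive)
open import Relation.Binary.Construct.Closure.ReflexiveTransitive using (Star)
open import Relation.Binary.PropositionalEquality using (_≡_)
open import Relation.Nullary.Decidable using (_×-dec_)

private
  variable
    ℓ : Level
    n : ℕ

record Graph (n : ℕ) : Set (suc 0ℓ) where
  field
    Adj    : Rel (Fin n) 0ℓ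
    adj?   : Decidable Adj
    sym    : Symmetric Adj
    irrefl : Irreflexive _≡_ Adj

-- A connected graph is usually also required to have a vertex; the orders
-- considered here are positive, so this is not repeated in the definition.
Connected : Graph n → Set
Connected G = ∀ u v → Star (Graph.Adj G) u v

record Subgraph (G : Graph n) : Set (suc 0ℓ) where
  field
    vertices  : Subset n
    Edge      : Rel (Fin n) 0ℓ
    edge?     : Decidable Edge
    sym       : Symmetric Edge
    edge⇒adj  : Edge ⇒ Graph.Adj G
    -- by symmetry, both endpoints of an edge are vertices
    endpoint  : ∀ {u v} → Edge u v → u ∈ vertices

module _ {G : Graph n} (H : Subgraph G) where
  open Subgraph H

  -- Each undirected edge is counted once, as the ordered pair (i , j) with i < j.
  size : ℕ
  size = length (filter (λ (i , j) → (i <? j) ×-dec edge? i j)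
                        (cartesianProduct (allFin n) (allFin n)))

  ConnectedSubgraph : Set
  ConnectedSubgraph = ∀ {u v} → u ∈ vertices → v ∈ vertices → Star Edge u v

-- Minima and maxima are given as relations: "m is the minimum (maximum) of the
-- set P of natural numbers".
IsMin : (ℕ → Set ℓ) → ℕ → Set ℓ
IsMin P m = P m × (∀ {x} → P x → m ≤ x)

IsMax : (ℕ → Set ℓ) → ℕ → Set ℓ
IsMax P m = P m × (∀ {x} → P x → x ≤ m)

module _ (G : Graph n) where

  -- d(S) = d, for non-empty S
  IsSteinerDistance : Subset n → ℕ → Set (suc 0ℓ)
  IsSteinerDistance S = IsMin λ m →
    ∃ λ (H : Subgraph G) →
      ConnectedSubgraph H × S ⊆ Subgraph.vertices H × size H ≡ m

  -- e_k(v) = e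
  IsSteinerEccentricity : (k : ℕ) → Fin n → ℕ → Set (suc 0ℓ)
  IsSteinerEccentricity k v = IsMax λ m →
    ∃ λ (S : Subset n) → ∣ S ∣ ≡ k × v ∈ S × IsSteinerDistance S m

  -- srad_k(G) = r
  IsSteinerRadius : (k : ℕ) → ℕ → Set (suc 0ℓ)
  IsSteinerRadius k = IsMin λ m → ∃ λ v → IsSteinerEccentricity k v m

  -- sdiam_k(G) = d
  IsSteinerDiameter : (k : ℕ) → ℕ → Set (suc 0ℓ)
  IsSteinerDiameter k = IsMax λ m → ∃ λ v → IsSteinerEccentricity k v m

{-# OPTIONS --safe #-}
module Submission where

-- Let D be four vertices with d(D) = sdiam, let v be a centre, and for i in D let T i be
-- a tree of size at most r on v and D − i. T i has a path from v to p of length α and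
-- from p to a partner of length β, a path from p to q of length μ, and paths from q to
-- the two far vertices of length γ and δ. Two kinds of connected graphs contain D:
-- T i with a path from v to i added, and T i without the path from v to p, with a path
-- from some j in D − i to i added. Applied to paths inside the trees they give
--   3 d(D) ≤ 4 r + 2 α_k + μ_k   for all k, and
--   2 d(D) + α_k + μ_i ≤ 3 r     if k is far in T i,
-- hence 7 d(D) + 2 μ_i ≤ 10 r + μ_k. Now choose i with μ_i maximal.

open import Defs
open import Data.Fin.Base using (Fin; zero; suc; punchIn; punchOut)
import Data.Fin.Base as Fin
import Data.Fin.Properties as Fin
open import Data.Fin.Subset using (Subset; inside; outside; ∣_∣; ⊤; ⊥; ⁅_⁆; _∪_; _-_)
  renaming (_∈_ to _∈ₛ_; _⊆_ to _⊆ₛ_)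
import Data.Fin.Subset.Properties as Subset
open import Data.Integer.Base as ℤ using (+_; +≤+)
import Data.Integer.Properties as ℤ
open import Data.List.Base using (List; []; _∷_; [_]; length; map; filter; allFin; cartesianProduct)
import Data.List.Extrema as Extrema
open import Data.List.Membership.Propositional using (_∈_; _∉_)
open import Data.List.Membership.Propositional.Properties
  using (∈-∃++; ∈-filter⁺; ∈-filter⁻; ∈-cartesianProduct⁺; ∈-allFin; ∈-map⁺)
import Data.List.Membership.DecPropositional as DecMembership
open import Data.List.Properties using (length-map)
open import Data.List.Relation.Binary.Permutation.Propositional.Properties
  using (shift; ↭-length; ∈-resp-↭)
open import Data.List.Relation.Binary.Subset.Propositional using (_⊆_)
open import Data.List.Relation.Unary.All as All using (All; []; _∷_)
open import Data.List.Relation.Unary.AllPairs using ([]; _∷_)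
open import Data.List.Relation.Unary.Any using (here; there)
open import Data.List.Relation.Unary.Unique.Propositional using (Unique)
import Data.List.Relation.Unary.Unique.Propositional.Properties as Unique
open import Data.Nat.Base as ℕ using (ℕ; zero; suc; _+_; z≤n; s≤s)
open import Data.Nat.Induction using (<-rec)
import Data.Nat.Properties as ℕ
open import Data.Nat.Tactic.RingSolver using (solve-∀)
open import Data.Product.Base using (_×_; _,_; ∃; proj₁; proj₂)
open import Data.Product.Properties using (≡-dec)
open import Data.Rational.Base using (_≤_; _*_; _/_)
import Data.Rational.Base as ℚ
import Data.Rational.Properties as ℚ
open import Data.Rational.Unnormalised.Base as ℚᵘ using (mkℚᵘ; *≤*)
import Data.Rational.Unnormalised.Properties as ℚᵘ
open import Data.Sum.Base as Sum using (_⊎_; inj₁; inj₂)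
open import Data.Vec.Base using (here; there; []; _∷_)
open import Effect.Monad using (RawMonad)
open import Function.Base using (_∘_; id)
open import Level using (Level; 0ℓ)
open import Relation.Binary.Construct.Closure.ReflexiveTransitive using (Star; ε; _◅_)
open import Relation.Binary.Core using (Rel)
open import Relation.Binary.Definitions using (Symmetric; tri<; tri≈; tri>)
open import Relation.Binary.PropositionalEquality
  using (_≡_; _≢_; refl; sym; trans; cong; subst; subst₂)
open import Relation.Nullary.Decidable using (yes; no; _×-dec_; _⊎-dec_; decidable-stable)
open import Relation.Nullary.Negation using (¬_; contradiction; ¬¬-map; ¬¬-Monad)

private
  variable
    ℓ : Level
    A : Set ℓ
    n : ℕ
    R R′ : Rel (Fin n) 0ℓ
    u v w x y z : Fin n
    vs xs : List (Fin n)

-- Counting in lists and minima of predicates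

-- Each head of `xs` is deleted from `ys` in turn. Both comparisons between the edges of a tree and
-- `size` rest on this count.
Unique-⊆⇒length≤ : {xs ys : List A} → Unique xs → xs ⊆ ys → length xs ℕ.≤ length ys
Unique-⊆⇒length≤ [] xs⊆ys = z≤n
Unique-⊆⇒length≤ {xs = x ∷ xs} (x≢xs ∷ unique) xs⊆ys
  with as , bs , refl ← ∈-∃++ (xs⊆ys (here refl)) =
  subst (suc (length xs) ℕ.≤_) (sym (↭-length (shift x as bs)))
    (s≤s (Unique-⊆⇒length≤ unique λ y∈xs → drop (All.lookup x≢xs y∈xs)
      (∈-resp-↭ (shift x as bs) (xs⊆ys (there y∈xs)))))
  where
  drop : ∀ {y zs} → x ≢ y → y ∈ x ∷ zs → y ∈ zs
  drop x≢y (here y≡x)   = contradiction (sym y≡x) x≢y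
  drop x≢y (there y∈zs) = y∈zs

-- If there were no minimum, well-founded induction would refute `P` at every number.
¬¬-minimum : {P : ℕ → Set ℓ} {m : ℕ} → P m → ¬ ¬ ∃ (IsMin P)
¬¬-minimum {P = P} {m} = <-rec (λ m → P m → ¬ ¬ ∃ (IsMin P))
  (λ m smaller Pm ¬min → ¬min (m , Pm , λ {x} Px → ℕ.≮⇒≥ λ x<m → smaller x<m Px ¬min)) m

≡-< : ∀ {a b c} → a ≡ b → a ℕ.< c → b ℕ.< c
≡-< refl a<c = a<c

-- Walks with lengths, and trees grown leaf by leaf

data Walk {n} (R : Rel (Fin n) 0ℓ) : Fin n → Fin n → ℕ → Set where
  []  : ∀ {u} → Walk R u u 0
  _∷_ : ∀ {u v w k} → R u v → Walk R v w k → Walk R u w (suc k)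

snoc : ∀ {k} → Walk R u v k → R v w → Walk R u w (suc k)
snoc []       e = e ∷ []
snoc (f ∷ fs) e = f ∷ snoc fs e

reverse : Symmetric R → ∀ {k} → Walk R u v k → Walk R v u k
reverse R-sym []       = []
reverse R-sym (e ∷ es) = snoc (reverse R-sym es) (R-sym e)

append : ∀ {k l} → Walk R u v k → Walk R v w l → Walk R u w (k + l)
append []       fs = fs
append (e ∷ es) fs = e ∷ append es fs

walk⇒star : ∀ {k} → Walk R u v k → Star R u v
walk⇒star []       = ε
walk⇒star (e ∷ es) = e ◅ walk⇒star es

star⇒walk : Star R u v → ∃ (Walk R u v)
star⇒walk ε        = 0 , []
star⇒walk (e ◅ es) = _ , e ∷ proj₂ (star⇒walk es)

-- A tree with edges in R and vertices vs; adding only leaves excludes cycles.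
data Tree {n} (R : Rel (Fin n) 0ℓ) : List (Fin n) → Set where
  root : ∀ r → Tree R [ r ]
  grow : ∀ {u w vs} → u ∈ vs → R u w → w ∉ vs → Tree R vs → Tree R (w ∷ vs)

edges : {R : Rel (Fin n) 0ℓ} {vs : List (Fin n)} → Tree R vs → List (Fin n × Fin n)
edges (root r) = []
edges (grow {u = u} {w = w} _ _ _ t) = (u , w) ∷ edges t

length-vertices : (t : Tree R vs) → length vs ≡ suc (length (edges t))
length-vertices (root r)       = refl
length-vertices (grow _ _ _ t) = cong suc (length-vertices t)

edges⊆R : (t : Tree R vs) → (u , w) ∈ edges t → R u w
edges⊆R (grow _ e _ t) (here refl) = e
edges⊆R (grow _ _ _ t) (there e∈t) = edges⊆R t e∈t

edges⊆vertices : (t : Tree R vs) → (u , w) ∈ edges t → u ∈ vs × w ∈ vs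
edges⊆vertices (grow u∈vs _ _ t) (here refl) = there u∈vs , here refl
edges⊆vertices (grow _    _ _ t) (there e∈t)
  with u∈ , w∈ ← edges⊆vertices t e∈t = there u∈ , there w∈

-- Lets a tree found inside a subgraph count as a tree of the graph, and a tree of the graph as one
-- inside its own subgraph.
rebase : (t : Tree R vs) → (∀ {u w} → (u , w) ∈ edges t → R′ u w) → Tree R′ vs
rebase (root r)              f = root r
rebase (grow u∈vs _ w∉vs t)  f = grow u∈vs (f (here refl)) w∉vs (rebase t (f ∘ there))

-- A step of the walk into a vertex of the tree adds nothing, and any other step adds one leaf. So
-- no cycle arises and each step costs at most one vertex.
attach : ∀ {k} → Tree R vs → u ∈ vs → Walk R u w k →
  ∃ λ vs′ → Tree R vs′ × vs ⊆ vs′ × w ∈ vs′ × length vs′ ℕ.≤ k + length vs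
attach t u∈vs [] = _ , t , id , u∈vs , ℕ.≤-refl
attach {vs = vs} {k = suc k} t u∈vs (_∷_ {v = v} e es) with DecMembership._∈?_ Fin._≟_ v vs
... | yes v∈vs with vs′ , t′ , vs⊆ , w∈ , len ← attach t v∈vs es =
  vs′ , t′ , vs⊆ , w∈ , ℕ.m≤n⇒m≤1+n len
... | no  v∉vs with vs′ , t′ , vs⊆ , w∈ , len ← attach (grow u∈vs e v∉vs t) (here refl) es =
  vs′ , t′ , vs⊆ ∘ there , w∈ , subst (length vs′ ℕ.≤_) (ℕ.+-suc k (length vs)) len

-- The walks are attached one after another. The order of the result is controlled afterwards, by
-- `edges≤size`.
spanningTree : Tree R vs → v ∈ vs → All (λ x → Star R v x) xs →
  ∃ λ vs′ → Tree R vs′ × vs ⊆ vs′ × xs ⊆ vs′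
spanningTree t v∈vs [] = _ , t , id , λ ()
spanningTree t v∈vs (s ∷ ss)
  with vs₁ , t₁ , vs⊆  , x∈ , _ ← attach t v∈vs (proj₂ (star⇒walk s))
  with vs₂ , t₂ , vs₁⊆ , xs⊆    ← spanningTree t₁ (vs⊆ v∈vs) ss =
  vs₂ , t₂ , vs₁⊆ ∘ vs⊆ , λ { (here refl) → vs₁⊆ x∈ ; (there x∈xs) → xs⊆ x∈xs }

-- A walk from or to the newest leaf uses its only edge once and otherwise stays in the older tree.
treeWalk : Symmetric R → Tree R vs → x ∈ vs → y ∈ vs → ∃ λ k → k ℕ.< length vs × Walk R x y k
treeWalk R-sym (root r) (here refl) (here refl) = 0 , s≤s z≤n , []
treeWalk R-sym (grow u∈ e _ t) (here refl) (here refl) = 0 , s≤s z≤n , []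
treeWalk R-sym (grow u∈ e _ t) (here refl) (there y∈)
  with k , k< , es ← treeWalk R-sym t u∈ y∈ = suc k , s≤s k< , R-sym e ∷ es
treeWalk R-sym (grow u∈ e _ t) (there x∈) (here refl)
  with k , k< , es ← treeWalk R-sym t x∈ u∈ = suc k , s≤s k< , snoc es e
treeWalk R-sym (grow u∈ e _ t) (there x∈) (there y∈)
  with k , k< , es ← treeWalk R-sym t x∈ y∈ = k , ℕ.m<n⇒m<1+n k< , es

-- Trees and connected subgraphs

orient : Fin n × Fin n → Fin n × Fin n
orient (u , w) with u Fin.<? w
... | yes _ = u , w
... | no  _ = w , u

orient-< : ∀ {n} {u w x y : Fin n} → (u , w) ≡ (x , y) ⊎ (w , u) ≡ (x , y) →
  x Fin.< y → orient (u , w) ≡ (x , y)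
orient-< {u = u} {w} (inj₁ refl) u<w with u Fin.<? w
... | yes _   = refl
... | no  u≮w = contradiction u<w u≮w
orient-< {u = u} {w} (inj₂ refl) w<u with u Fin.<? w
... | yes u<w = contradiction u<w (Fin.<-asym w<u)
... | no  _   = refl

orient-cases : ∀ (u w : Fin n) → orient (u , w) ≡ (u , w) ⊎ orient (u , w) ≡ (w , u)
orient-cases u w with u Fin.<? w
... | yes _ = inj₁ refl
... | no  _ = inj₂ refl

support : List (Fin n) → Subset n
support []       = ⊥
support (v ∷ vs) = ⁅ v ⁆ ∪ support vs

∈-support⁺ : v ∈ vs → v ∈ₛ support vs
∈-support⁺ (here refl)  = Subset.x∈p∪q⁺ (inj₁ (Subset.x∈⁅x⁆ _))
∈-support⁺ (there v∈vs) = Subset.x∈p∪q⁺ (inj₂ (∈-support⁺ v∈vs))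

∈-support⁻ : ∀ vs → v ∈ₛ support vs → v ∈ vs
∈-support⁻ []       v∈⊥ = contradiction v∈⊥ Subset.∉⊥
∈-support⁻ (x ∷ vs) v∈  = Sum.[ here ∘ Subset.x∈⁅y⁆⇒x≡y x , there ∘ ∈-support⁻ vs ]
  (Subset.x∈p∪q⁻ ⁅ x ⁆ (support vs) v∈)

pairs-unique : Unique (cartesianProduct (allFin n) (allFin n))
pairs-unique = Unique.cartesianProduct⁺ (Unique.allFin⁺ _) (Unique.allFin⁺ _)

module _ {G : Graph n} where
  open Graph G using (Adj)

  module _ (t : Tree Adj vs) where

    treeSubgraph : Subgraph G
    treeSubgraph = record
      { vertices = support vs
      ; Edge     = λ u w → (u , w) ∈ edges t ⊎ (w , u) ∈ edges t
      ; edge?    = λ u w → ((u , w) ∈? edges t) ⊎-dec ((w , u) ∈? edges t)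
      ; sym      = Sum.swap
      ; edge⇒adj = Sum.[ edges⊆R t , Graph.sym G ∘ edges⊆R t ]
      ; endpoint = Sum.[ ∈-support⁺ ∘ proj₁ ∘ edges⊆vertices t
                       , ∈-support⁺ ∘ proj₂ ∘ edges⊆vertices t ]
      }
      where open DecMembership (≡-dec Fin._≟_ Fin._≟_) using (_∈?_)

    treeSubgraph-connected : ConnectedSubgraph treeSubgraph
    treeSubgraph-connected u∈ v∈
      with treeWalk Sum.swap (rebase t inj₁) (∈-support⁻ vs u∈) (∈-support⁻ vs v∈)
    ... | _ , _ , es = walk⇒star es

    -- The pairs counted by `size` are distinct, and each is an edge of `t` put in increasing order.
    treeSubgraph-size : size treeSubgraph ℕ.≤ length (edges t)
    treeSubgraph-size = subst (size treeSubgraph ℕ.≤_) (length-map orient (edges t))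
      (Unique-⊆⇒length≤ (Unique.filter⁺ oriented? pairs-unique)
         λ e∈ → oriented (proj₂ (∈-filter⁻ oriented? {xs = cartesianProduct (allFin n) (allFin n)} e∈)))
      where
      oriented? = λ ((i , j) : Fin n × Fin n) → (i Fin.<? j) ×-dec Subgraph.edge? treeSubgraph i j

      oriented : ∀ {e : Fin n × Fin n} → let (i , j) = e in
        i Fin.< j × ((i , j) ∈ edges t ⊎ (j , i) ∈ edges t) → e ∈ map orient (edges t)
      oriented (i<j , inj₁ e∈) = subst (_∈ _) (orient-< (inj₁ refl) i<j) (∈-map⁺ orient e∈)
      oriented (i<j , inj₂ e∈) = subst (_∈ _) (orient-< (inj₂ refl) i<j) (∈-map⁺ orient e∈)

  module _ (H : Subgraph G) where
    open Subgraph H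

    -- The oriented edges of `t` are distinct, because a new edge contains its leaf and no older
    -- edge does. Each of them is counted by `size H`.
    edges≤size : (t : Tree Edge vs) → length (edges t) ℕ.≤ size H
    edges≤size t = subst (ℕ._≤ size H) (length-map orient (edges t))
      (Unique-⊆⇒length≤ (unique t) (oriented t))
      where
      endpoints : (t : Tree Edge vs) → All (λ (u , w) → u ∈ vs × w ∈ vs) (map orient (edges t))
      endpoints (root r) = []
      endpoints (grow {u = u} {w = w} u∈ e _ t) with orient (u , w) | orient-cases u w
      ... | _ | inj₁ refl = (there u∈ , here refl) ∷ All.map (λ (p , q) → there p , there q) (endpoints t)
      ... | _ | inj₂ refl = (here refl , there u∈) ∷ All.map (λ (p , q) → there p , there q) (endpoints t)

      unique : (t : Tree Edge vs) → Unique (map orient (edges t))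
      unique (root r) = []
      unique (grow {u = u} {w = w} u∈ e w∉ t) with orient (u , w) | orient-cases u w
      ... | _ | inj₁ refl = All.map (λ { (_ , q) refl → w∉ q }) (endpoints t) ∷ unique t
      ... | _ | inj₂ refl = All.map (λ { (p , _) refl → w∉ p }) (endpoints t) ∷ unique t

      oriented : (t : Tree Edge vs) → map orient (edges t) ⊆
        filter (λ (i , j) → (i Fin.<? j) ×-dec edge? i j) (cartesianProduct (allFin n) (allFin n))
      oriented (grow {u = u} {w = w} u∈ e w∉ t) (here refl) =
        ∈-filter⁺ _ (∈-cartesianProduct⁺ (∈-allFin _) (∈-allFin _)) ordered
        where
        orient-to : ∀ {e} → orient (u , w) ≡ e → let (i , j) = e in
          i Fin.< j × Edge i j → let (i , j) = orient (u , w) in i Fin.< j × Edge i j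
        orient-to refl p = p

        ordered : let (i , j) = orient (u , w) in i Fin.< j × Edge i j
        ordered with Fin.<-cmp u w
        ... | tri< u<w _ _  = orient-to (orient-< (inj₁ refl) u<w) (u<w , e)
        -- A new leaf differs from its neighbour, which is already in the tree.
        ... | tri≈ _ refl _ = contradiction u∈ w∉
        ... | tri> _ _ w<u  = orient-to (orient-< (inj₂ refl) w<u) (w<u , Subgraph.sym H e)
      oriented (grow _ _ _ t) (there e∈) = oriented t e∈

-- Decomposition of a tree along three or four of its vertices, which need not be distinct

-- Only the total length of the legs is recorded, not that they are disjoint. With `N` the number of
-- vertices of a tree, the strict `bound` says that the total is at most its number of edges.
record Tripod {n} (R : Rel (Fin n) 0ℓ) (N : ℕ) (x y z : Fin n) : Set where
  constructor tripod
  field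
    {centre} : Fin n
    {a b c}  : ℕ
    legx     : Walk R x centre a
    legy     : Walk R y centre b
    legz     : Walk R z centre c
    bound    : a + b + c ℕ.< N

-- If two of the vertices are the newest leaf, one of them can be dropped; otherwise at most
-- one of them is, and it is replaced by its neighbour. The same works for four vertices.
treeTripod : Symmetric R → Tree R vs → x ∈ vs → y ∈ vs → z ∈ vs → Tripod R (length vs) x y z
treeTripod R-sym t (here refl) (here refl) z∈
  with _ , k< , es ← treeWalk R-sym t z∈ (here refl) =
  tripod [] [] es k<
treeTripod R-sym t (here refl) y∈@(there _) (here refl)
  with k , k< , es ← treeWalk R-sym t y∈ (here refl) =
  tripod [] es [] (≡-< (sym (ℕ.+-identityʳ k)) k<)
treeTripod R-sym t x∈@(there _) (here refl) (here refl)
  with k , k< , es ← treeWalk R-sym t x∈ (here refl) =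
  tripod es [] [] (≡-< (eq k) k<)
  where
  eq : ∀ k → k ≡ k + 0 + 0
  eq = solve-∀
treeTripod R-sym (grow u∈ e _ t) (here refl) (there y∈) (there z∈)
  with tripod es fs gs b< ← treeTripod R-sym t u∈ y∈ z∈ =
  tripod (R-sym e ∷ es) fs gs (s≤s b<)
treeTripod R-sym (grow u∈ e _ t) (there x∈) (here refl) (there z∈)
  with tripod {a = a} {b} {c} es fs gs b< ← treeTripod R-sym t x∈ u∈ z∈ =
  tripod es (R-sym e ∷ fs) gs (≡-< (eq a b c) (s≤s b<))
  where
  eq : ∀ a b c → suc (a + b + c) ≡ a + suc b + c
  eq = solve-∀
treeTripod R-sym (grow u∈ e _ t) (there x∈) (there y∈) (here refl)
  with tripod {a = a} {b} {c} es fs gs b< ← treeTripod R-sym t x∈ y∈ u∈ =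
  tripod es fs (R-sym e ∷ gs) (≡-< (sym (ℕ.+-suc (a + b) c)) (s≤s b<))
treeTripod R-sym (grow _ _ _ t) (there x∈) (there y∈) (there z∈)
  with tripod es fs gs b< ← treeTripod R-sym t x∈ y∈ z∈ =
  tripod es fs gs (ℕ.m<n⇒m<1+n b<)

-- With p the branch point of x₀, exactly one of x₁, x₂, x₃ is attached at p, the others at q.
data Topology {A : Set} (p q : A) : A → A → A → Set where
  pqq : Topology p q p q q
  qpq : Topology p q q p q
  qqp : Topology p q q q p

record Quartet {n} (R : Rel (Fin n) 0ℓ) (N : ℕ) (x₀ x₁ x₂ x₃ : Fin n) : Set where
  constructor quartet
  field
    {p q c₁ c₂ c₃}   : Fin n
    {m a₀ a₁ a₂ a₃}  : ℕ
    topology         : Topology p q c₁ c₂ c₃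
    middle           : Walk R p q m
    leg₀             : Walk R x₀ p a₀
    leg₁             : Walk R x₁ c₁ a₁
    leg₂             : Walk R x₂ c₂ a₂
    leg₃             : Walk R x₃ c₃ a₃
    bound            : m + a₀ + a₁ + a₂ + a₃ ℕ.< N

treeQuartet : ∀ {x₀ x₁ x₂ x₃} → Symmetric R → Tree R vs →
  x₀ ∈ vs → x₁ ∈ vs → x₂ ∈ vs → x₃ ∈ vs → Quartet R (length vs) x₀ x₁ x₂ x₃
-- When `x₀` is one of two equal vertices, it serves as `p` itself, and its leg in the tripod
-- becomes the middle.
treeQuartet R-sym t 0∈@(here refl) (here refl) 2∈ 3∈
  with tripod {a = a} {b} {c} es fs gs b< ← treeTripod R-sym t 0∈ 2∈ 3∈ =
  quartet pqq es [] [] fs gs (≡-< (eq a b c) b<)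
  where
  eq : ∀ a b c → a + b + c ≡ a + 0 + 0 + b + c
  eq = solve-∀
treeQuartet R-sym t 0∈@(here refl) 1∈@(there _) (here refl) 3∈
  with tripod {a = a} {b} {c} es fs gs b< ← treeTripod R-sym t 0∈ 1∈ 3∈ =
  quartet qpq es [] fs [] gs (≡-< (eq a b c) b<)
  where
  eq : ∀ a b c → a + b + c ≡ a + 0 + b + 0 + c
  eq = solve-∀
treeQuartet R-sym t 0∈@(here refl) 1∈@(there _) 2∈@(there _) (here refl)
  with tripod {a = a} {b} {c} es fs gs b< ← treeTripod R-sym t 0∈ 1∈ 2∈ =
  quartet qqp es [] fs gs [] (≡-< (eq a b c) b<)
  where
  eq : ∀ a b c → a + b + c ≡ a + 0 + b + c + 0
  eq = solve-∀
-- When `x₀` is not the leaf, the two equal vertices form the pair at `q`, and the centre of the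
-- tripod becomes `p`.
treeQuartet R-sym t 0∈@(there _) 1∈@(here refl) (here refl) 3∈
  with tripod {a = a} {b} {c} es fs gs b< ← treeTripod R-sym t 1∈ 0∈ 3∈ =
  quartet qqp (reverse R-sym es) fs [] [] gs (≡-< (eq a b c) b<)
  where
  eq : ∀ a b c → a + b + c ≡ a + b + 0 + 0 + c
  eq = solve-∀
treeQuartet R-sym t 0∈@(there _) 1∈@(here refl) 2∈@(there _) (here refl)
  with tripod {a = a} {b} {c} es fs gs b< ← treeTripod R-sym t 1∈ 0∈ 2∈ =
  quartet qpq (reverse R-sym es) fs [] gs [] (≡-< (eq a b c) b<)
  where
  eq : ∀ a b c → a + b + c ≡ a + b + 0 + c + 0
  eq = solve-∀
treeQuartet R-sym t 0∈@(there _) 1∈@(there _) 2∈@(here refl) (here refl)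
  with tripod {a = a} {b} {c} es fs gs b< ← treeTripod R-sym t 2∈ 0∈ 1∈ =
  quartet pqq (reverse R-sym es) fs gs [] [] (≡-< (eq a b c) b<)
  where
  eq : ∀ a b c → a + b + c ≡ a + b + c + 0 + 0
  eq = solve-∀
treeQuartet R-sym (grow u∈ e _ t) (here refl) (there 1∈) (there 2∈) (there 3∈)
  with quartet {m = m} {a₀} {a₁} {a₂} {a₃} top es l₀ l₁ l₂ l₃ b< ← treeQuartet R-sym t u∈ 1∈ 2∈ 3∈ =
  quartet top es (R-sym e ∷ l₀) l₁ l₂ l₃ (≡-< (eq m a₀ a₁ a₂ a₃) (s≤s b<))
  where
  eq : ∀ m a b c d → suc (m + a + b + c + d) ≡ m + suc a + b + c + d
  eq = solve-∀
treeQuartet R-sym (grow u∈ e _ t) (there 0∈) (here refl) (there 2∈) (there 3∈)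
  with quartet {m = m} {a₀} {a₁} {a₂} {a₃} top es l₀ l₁ l₂ l₃ b< ← treeQuartet R-sym t 0∈ u∈ 2∈ 3∈ =
  quartet top es l₀ (R-sym e ∷ l₁) l₂ l₃ (≡-< (eq m a₀ a₁ a₂ a₃) (s≤s b<))
  where
  eq : ∀ m a b c d → suc (m + a + b + c + d) ≡ m + a + suc b + c + d
  eq = solve-∀
treeQuartet R-sym (grow u∈ e _ t) (there 0∈) (there 1∈) (here refl) (there 3∈)
  with quartet {m = m} {a₀} {a₁} {a₂} {a₃} top es l₀ l₁ l₂ l₃ b< ← treeQuartet R-sym t 0∈ 1∈ u∈ 3∈ =
  quartet top es l₀ l₁ (R-sym e ∷ l₂) l₃ (≡-< (eq m a₀ a₁ a₂ a₃) (s≤s b<))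
  where
  eq : ∀ m a b c d → suc (m + a + b + c + d) ≡ m + a + b + suc c + d
  eq = solve-∀
treeQuartet R-sym (grow u∈ e _ t) (there 0∈) (there 1∈) (there 2∈) (here refl)
  with quartet {m = m} {a₀} {a₁} {a₂} {a₃} top es l₀ l₁ l₂ l₃ b< ← treeQuartet R-sym t 0∈ 1∈ 2∈ u∈ =
  quartet top es l₀ l₁ l₂ (R-sym e ∷ l₃) (≡-< (sym (ℕ.+-suc (m + a₀ + a₁ + a₂) a₃)) (s≤s b<))
treeQuartet R-sym (grow _ _ _ t) (there 0∈) (there 1∈) (there 2∈) (there 3∈)
  with quartet top es l₀ l₁ l₂ l₃ b< ← treeQuartet R-sym t 0∈ 1∈ 2∈ 3∈ =
  quartet top es l₀ l₁ l₂ l₃ (ℕ.m<n⇒m<1+n b<)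

-- Cardinalities of subsets

-- Eccentricity speaks of sets with exactly `k` elements, whereas exchanging a vertex for the centre
-- yields fewer if the centre is among the remaining ones.
extend : ∀ {k} (S : Subset n) → ∣ S ∣ ℕ.≤ k → k ℕ.≤ n → ∃ λ T → S ⊆ₛ T × ∣ T ∣ ≡ k
extend [] z≤n z≤n = [] , id , refl
extend (inside ∷ S) (s≤s S≤k) (s≤s k≤n) with T , S⊆T , refl ← extend S S≤k k≤n =
  inside ∷ T , (λ { here → here ; (there x∈) → there (S⊆T x∈) }) , refl
extend {k = zero} (outside ∷ S) S≤k k≤n with T , S⊆T , eq ← extend S S≤k z≤n =
  outside ∷ T , (λ { (there x∈) → there (S⊆T x∈) }) , eq
extend {k = suc k} (outside ∷ S) S≤k (s≤s k≤n) with ∣ S ∣ ℕ.≤? k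
... | yes S≤k′ with T , S⊆T , refl ← extend S S≤k′ k≤n =
  inside ∷ T , (λ { (there x∈) → there (S⊆T x∈) }) , refl
... | no  S≰k = outside ∷ S , id , ℕ.≤-antisym S≤k (ℕ.≰⇒> S≰k)

enumerate : (S : Subset n) → ∃ λ (t : Fin ∣ S ∣ → Fin n) →
  (∀ i → t i ∈ₛ S) × (∀ {i j} → t i ≡ t j → i ≡ j) × (∀ {x} → x ∈ₛ S → ∃ λ i → x ≡ t i)
enumerate [] = (λ ()) , (λ ()) , (λ { {()} }) , λ ()
enumerate (outside ∷ S) with t , t∈ , inj , surj ← enumerate S =
  suc ∘ t , there ∘ t∈ , inj ∘ Fin.suc-injective ,
  λ { (there x∈) → let i , eq = surj x∈ in i , cong suc eq }
enumerate (inside ∷ S) with t , t∈ , inj , surj ← enumerate S =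
  (λ { zero → zero ; (suc i) → suc (t i) }) ,
  (λ { zero → here ; (suc i) → there (t∈ i) }) ,
  (λ { {zero} {zero} _ → refl ; {suc i} {suc j} eq → cong suc (inj (Fin.suc-injective eq)) }) ,
  λ { here → zero , refl ; (there x∈) → let i , eq = surj x∈ in suc i , cong suc eq }

∣p∪⁅x⁆∣≤1+∣p∣ : (S : Subset n) (x : Fin n) → ∣ S ∪ ⁅ x ⁆ ∣ ℕ.≤ suc ∣ S ∣
∣p∪⁅x⁆∣≤1+∣p∣ (inside  ∷ S) zero    =
  s≤s (subst (λ T → ∣ T ∣ ℕ.≤ suc ∣ S ∣) (sym (Subset.∪-identityʳ S)) (ℕ.n≤1+n _))
∣p∪⁅x⁆∣≤1+∣p∣ (outside ∷ S) zero    = s≤s (ℕ.≤-reflexive (cong ∣_∣ (Subset.∪-identityʳ S)))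
∣p∪⁅x⁆∣≤1+∣p∣ (inside  ∷ S) (suc x) = s≤s (∣p∪⁅x⁆∣≤1+∣p∣ S x)
∣p∪⁅x⁆∣≤1+∣p∣ (outside ∷ S) (suc x) = ∣p∪⁅x⁆∣≤1+∣p∣ S x

∣p-x∪⁅y⁆∣≤∣p∣ : {S : Subset n} → x ∈ₛ S → ∀ y → ∣ (S - x) ∪ ⁅ y ⁆ ∣ ℕ.≤ ∣ S ∣
∣p-x∪⁅y⁆∣≤∣p∣ {x = x} {S = S} x∈S y =
  ℕ.≤-trans (∣p∪⁅x⁆∣≤1+∣p∣ (S - x) y) (Subset.p⊂q⇒∣p∣<∣q∣ (Subset.x∈p⇒p-x⊂p x∈S))

-- Steiner distance expressed by trees

module _ (G : Graph n) where
  open Graph G using (Adj)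

  -- Vertices are counted instead of edges, so `suc k` stands for `k` edges. `subgraphConnects` and
  -- `steinerDistance≤` translate from and to connected subgraphs.
  record Connects (xs : List (Fin n)) (k : ℕ) : Set where
    constructor connects
    field
      {vertices} : List (Fin n)
      tree       : Tree Adj vertices
      covers     : xs ⊆ vertices
      order      : length vertices ℕ.≤ suc k

  connectsOne : ∀ v → Connects [ v ] 0
  connectsOne v = connects (root v) id (s≤s z≤n)

  join : ∀ {u w k l} → Connects xs k → u ∈ xs → Walk Adj u w l → Connects (w ∷ xs) (k + l)
  join {k = k} {l} (connects t xs⊆ ord) u∈ es
    with vs′ , t′ , vs⊆ , w∈ , len ← attach t (xs⊆ u∈) es =
    connects t′ (λ { (here refl) → w∈ ; (there x∈) → vs⊆ (xs⊆ x∈) })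
      (ℕ.≤-trans len (ℕ.≤-trans (ℕ.+-monoʳ-≤ l ord) (ℕ.≤-reflexive (eq k l))))
    where
    eq : ∀ k l → l + suc k ≡ suc (k + l)
    eq = solve-∀

  -- The tree is grown from edges of `H`, where its size is bounded, and only then regarded as a
  -- tree of `G`.
  subgraphConnects : (H : Subgraph G) → ConnectedSubgraph H → ∀ {x xs} →
    All (_∈ₛ Subgraph.vertices H) (x ∷ xs) → Connects (x ∷ xs) (size H)
  subgraphConnects H conn {x} {xs} (x∈ ∷ xs∈)
    with vs , t , x⊆ , xs⊆ ← spanningTree (root x) (here refl) (All.map (conn x∈) xs∈) =
    connects (rebase t (Subgraph.edge⇒adj H ∘ edges⊆R t))
      (λ { (here refl) → x⊆ (here refl) ; (there y∈) → xs⊆ y∈ })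
      (subst (ℕ._≤ _) (sym (length-vertices t)) (s≤s (edges≤size H t)))

  steinerDistance≤ : ∀ {S d k} → IsSteinerDistance G S d → Connects xs k →
    (∀ {x} → x ∈ₛ S → x ∈ xs) → d ℕ.≤ k
  steinerDistance≤ (_ , minimal) (connects t xs⊆ ord) S⊆ = ℕ.≤-trans
    (minimal (treeSubgraph t , treeSubgraph-connected {G = G} t , ∈-support⁺ ∘ xs⊆ ∘ S⊆ , refl))
    (ℕ.≤-trans (treeSubgraph-size {G = G} t) (ℕ.s≤s⁻¹ (subst (ℕ._≤ _) (length-vertices t) ord)))

  wholeGraph : Subgraph G
  wholeGraph = record
    { vertices = ⊤ ; Edge = Adj ; edge? = Graph.adj? G ; sym = Graph.sym G
    ; edge⇒adj = id ; endpoint = λ _ → Subset.∈⊤ }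

  -- The minimum over all subgraphs exists only up to double negation, which suffices
  -- because the final inequality is decidable.
  ¬¬-steinerDistance : Connected G → ∀ S → ¬ ¬ ∃ (IsSteinerDistance G S)
  ¬¬-steinerDistance conn S =
    ¬¬-minimum (wholeGraph , (λ {u} {v} _ _ → conn u v) , (λ {_} _ → Subset.∈⊤) , refl)

  -- `S` is enlarged to a set `T` of exactly `k` vertices. As `T` contains `v`, its Steiner distance
  -- is at most `r`, and an optimal subgraph for `T` also contains `S`.
  eccentricity-connects : Connected G → ∀ {k v r} → IsSteinerEccentricity G k v r → k ℕ.≤ n →
    ∀ {S} → ∣ S ∣ ℕ.≤ k → v ∈ₛ S → ∀ {x xs} → All (_∈ₛ S) (x ∷ xs) → ¬ ¬ Connects (x ∷ xs) r
  eccentricity-connects conn (_ , maximal) k≤n {S} S≤k v∈S xs∈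
    with T , S⊆T , ∣T∣≡k ← extend S S≤k k≤n = ¬¬-map weaken (¬¬-steinerDistance conn T)
    where
    weaken : ∃ (IsSteinerDistance G T) → Connects _ _
    weaken (m , sd@((H , H-conn , T⊆H , refl) , _))
      with connects t xs⊆ ord ← subgraphConnects H H-conn (All.map (T⊆H ∘ S⊆T) xs∈) =
      connects t xs⊆ (ℕ.≤-trans ord (s≤s (maximal (T , ∣T∣≡k , S⊆T v∈S , sd))))

-- The inequality for four vertices and a centre

punchIn-covers : ∀ (i j : Fin (suc n)) → j ≡ i ⊎ ∃ λ c → j ≡ punchIn i c
punchIn-covers i j with i Fin.≟ j
... | yes refl = inj₁ refl
... | no  i≢j  = inj₂ (punchOut i≢j , sym (Fin.punchIn-punchOut i≢j))

-- Here `D` is a number: it stands for the Steiner distance of the four vertices `t j`, known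
-- through `lower`.
module _ {G : Graph n} {t : Fin 4 → Fin n} {v : Fin n} {D r : ℕ}
  (lower : ∀ {xs k} → Connects G xs k → (∀ j → t j ∈ xs) → D ℕ.≤ k)
  (trees : ∀ i → Connects G (v ∷ map (t ∘ punchIn i) (allFin 3)) r)
  where
  open Graph G using (Adj)

  -- A decomposition of the tree spanning v and all t j with j ≢ i.
  record Split (i : Fin 4) : Set where
    field
      {partner far₁ far₂} : Fin 4
      covers     : ∀ j → j ∈ i ∷ partner ∷ far₁ ∷ far₂ ∷ []
      -- Allows the pruned tree for `far₁` to be extended from `far₂`.
      far₂≢far₁  : far₂ ≢ far₁
      {p q}      : Fin n
      {μ α β γ δ} : ℕ
      middle     : Walk Adj p q μ
      legᵥ       : Walk Adj v p α
      partnerLeg : Walk Adj (t partner) p β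
      far₁Leg    : Walk Adj (t far₁) q γ
      far₂Leg    : Walk Adj (t far₂) q δ
      bound      : μ + α + β + γ + δ ℕ.≤ r

  -- `v` is the first vertex of the quartet, so the partner is the one sharing `p` with it. The
  -- three topologies differ only in which vertex that is.
  split : ∀ i → Split i
  split i with connects tree xs⊆ order ← trees i
    with treeQuartet (Graph.sym G) tree (xs⊆ (here refl)) (xs⊆ (there (here refl)))
           (xs⊆ (there (there (here refl)))) (xs⊆ (there (there (there (here refl)))))
  ... | quartet pqq es l₀ l₁ l₂ l₃ b< = record
    { covers = covers ; far₂≢far₁ = (λ ()) ∘ Fin.punchIn-injective i _ _
    ; middle = es ; legᵥ = l₀ ; partnerLeg = l₁ ; far₁Leg = l₂ ; far₂Leg = l₃
    ; bound = ℕ.s≤s⁻¹ (ℕ.≤-trans b< order) }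
    where
    covers : ∀ j → j ∈ i ∷ punchIn i zero ∷ punchIn i (suc zero) ∷ punchIn i (suc (suc zero)) ∷ []
    covers j with punchIn-covers i j
    ... | inj₁ eq                       = here eq
    ... | inj₂ (zero , eq)              = there (here eq)
    ... | inj₂ (suc zero , eq)          = there (there (here eq))
    ... | inj₂ (suc (suc zero) , eq)    = there (there (there (here eq)))
  ... | quartet {m = m} {a₀} {a₁} {a₂} {a₃} qpq es l₀ l₁ l₂ l₃ b< = record
    { covers = covers ; far₂≢far₁ = (λ ()) ∘ Fin.punchIn-injective i _ _
    ; middle = es ; legᵥ = l₀ ; partnerLeg = l₂ ; far₁Leg = l₁ ; far₂Leg = l₃
    ; bound = subst (ℕ._≤ r) (eq m a₀ a₁ a₂ a₃) (ℕ.s≤s⁻¹ (ℕ.≤-trans b< order)) }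
    where
    covers : ∀ j → j ∈ i ∷ punchIn i (suc zero) ∷ punchIn i zero ∷ punchIn i (suc (suc zero)) ∷ []
    covers j with punchIn-covers i j
    ... | inj₁ eq                       = here eq
    ... | inj₂ (zero , eq)              = there (there (here eq))
    ... | inj₂ (suc zero , eq)          = there (here eq)
    ... | inj₂ (suc (suc zero) , eq)    = there (there (there (here eq)))
    eq : ∀ m a b c d → m + a + b + c + d ≡ m + a + c + b + d
    eq = solve-∀
  ... | quartet {m = m} {a₀} {a₁} {a₂} {a₃} qqp es l₀ l₁ l₂ l₃ b< = record
    { covers = covers ; far₂≢far₁ = (λ ()) ∘ Fin.punchIn-injective i _ _
    ; middle = es ; legᵥ = l₀ ; partnerLeg = l₃ ; far₁Leg = l₁ ; far₂Leg = l₂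
    ; bound = subst (ℕ._≤ r) (eq m a₀ a₁ a₂ a₃) (ℕ.s≤s⁻¹ (ℕ.≤-trans b< order)) }
    where
    covers : ∀ j → j ∈ i ∷ punchIn i (suc (suc zero)) ∷ punchIn i zero ∷ punchIn i (suc zero) ∷ []
    covers j with punchIn-covers i j
    ... | inj₁ eq                       = here eq
    ... | inj₂ (zero , eq)              = there (there (here eq))
    ... | inj₂ (suc zero , eq)          = there (there (there (here eq)))
    ... | inj₂ (suc (suc zero) , eq)    = there (here eq)
    eq : ∀ m a b c d → m + a + b + c + d ≡ m + a + d + b + c
    eq = solve-∀

  extendFromCentre : ∀ i {k} → Walk Adj v (t i) k → D ℕ.≤ r + k
  extendFromCentre i es = lower (join G (trees i) (here refl) es) covers
    where
    covers : ∀ j → t j ∈ t i ∷ v ∷ map (t ∘ punchIn i) (allFin 3)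
    covers j with punchIn-covers i j
    ... | inj₁ refl       = here refl
    ... | inj₂ (c , refl) = there (there (∈-map⁺ (t ∘ punchIn i) (∈-allFin c)))

  -- Pruning may lose `v`, so the walk to `t i` starts at a remaining `t j`. The length saved is
  -- `α`.
  extendPruned : ∀ {i} (s : Split i) {j k} →
    j ≢ i → Walk Adj (t j) (t i) k → D + Split.α s ℕ.≤ r + k
  extendPruned {i} s {j} {k} j≢i es = begin
    D + α                                       ≤⟨ ℕ.+-monoˡ-≤ α
      (lower extended (λ l → extended-covers (∈-map⁺ t (covers l)))) ⟩
    μ + β + γ + δ + k + α                       ≡⟨ eq μ α β γ δ k ⟩
    μ + α + β + γ + δ + k                       ≤⟨ ℕ.+-monoˡ-≤ k bound ⟩
    r + k                                       ∎
    where
    open ℕ.≤-Reasoning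
    open Split s

    pruned : Connects G (t far₂ ∷ t far₁ ∷ t partner ∷ p ∷ q ∷ []) (μ + β + γ + δ)
    -- The walks are reassembled starting from `q`; the membership proofs select `q`, `p`, `q`, `q`
    -- as successive starting points.
    pruned = join G (join G (join G (join G (connectsOne G q)
      (here refl)                         (reverse (Graph.sym G) middle))
      (here refl)                         (reverse (Graph.sym G) partnerLeg))
      (there (there (here refl)))         (reverse (Graph.sym G) far₁Leg))
      (there (there (there (here refl)))) (reverse (Graph.sym G) far₂Leg)

    pruned-covers : j ∈ i ∷ partner ∷ far₁ ∷ far₂ ∷ [] →
      t j ∈ t far₂ ∷ t far₁ ∷ t partner ∷ p ∷ q ∷ []
    pruned-covers (here j≡i)                         = contradiction j≡i j≢i
    pruned-covers (there (here refl))                = there (there (here refl))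
    pruned-covers (there (there (here refl)))        = there (here refl)
    pruned-covers (there (there (there (here refl)))) = here refl

    extended : Connects G (t i ∷ t far₂ ∷ t far₁ ∷ t partner ∷ p ∷ q ∷ []) (μ + β + γ + δ + k)
    extended = join G pruned (pruned-covers (covers j)) es

    extended-covers : map t (i ∷ partner ∷ far₁ ∷ far₂ ∷ []) ⊆
      t i ∷ t far₂ ∷ t far₁ ∷ t partner ∷ p ∷ q ∷ []
    extended-covers (here eq)                          = here eq
    extended-covers (there (here eq))                  = there (there (there (here eq)))
    extended-covers (there (there (here eq)))          = there (there (here eq))
    extended-covers (there (there (there (here eq))))  = there (here eq)

    eq : ∀ μ α β γ δ k → μ + β + γ + δ + k + α ≡ μ + α + β + γ + δ + k
    eq = solve-∀

  -- The three distances from v to the other leaves of the tree for i sum up to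
  -- (μ + α + β + γ + δ) + 2 α + μ.
  distances-bound : ∀ {i} (s : Split i) → 3 ℕ.* D ℕ.≤ 4 ℕ.* r + 2 ℕ.* Split.α s + Split.μ s
  distances-bound s = begin
    3 ℕ.* D                                     ≡⟨ lhs D ⟩
    D + D + D                                   ≤⟨ ℕ.+-mono-≤ (ℕ.+-mono-≤
      (extendFromCentre partner (append legᵥ (reverse (Graph.sym G) partnerLeg)))
      (extendFromCentre far₁ (append legᵥ (append middle (reverse (Graph.sym G) far₁Leg)))))
      (extendFromCentre far₂ (append legᵥ (append middle (reverse (Graph.sym G) far₂Leg)))) ⟩
    (r + (α + β)) + (r + (α + (μ + γ))) + (r + (α + (μ + δ))) ≡⟨ rhs r μ α β γ δ ⟩
    (μ + α + β + γ + δ) + (3 ℕ.* r + 2 ℕ.* α + μ)≤⟨ ℕ.+-monoˡ-≤ _ bound ⟩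
    r + (3 ℕ.* r + 2 ℕ.* α + μ)                 ≡⟨ final r α μ ⟩
    4 ℕ.* r + 2 ℕ.* α + μ                       ∎
    where
    open ℕ.≤-Reasoning
    open Split s

    lhs : ∀ D → 3 ℕ.* D ≡ D + D + D
    lhs = solve-∀

    rhs : ∀ r μ α β γ δ → (r + (α + β)) + (r + (α + (μ + γ))) + (r + (α + (μ + δ)))
                        ≡ (μ + α + β + γ + δ) + (3 ℕ.* r + 2 ℕ.* α + μ)
    rhs = solve-∀

    final : ∀ r α μ → r + (3 ℕ.* r + 2 ℕ.* α + μ) ≡ 4 ℕ.* r + 2 ℕ.* α + μ
    final = solve-∀

  -- The walks from `v` to the partner and between the far vertices both come from the tree for `i`
  -- and together leave out just the middle, which accounts for the term `μ`.
  middle-bound : ∀ {i} (s : Split i) (s′ : Split (Split.far₁ s)) →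
    2 ℕ.* D + Split.α s′ + Split.μ s ℕ.≤ 3 ℕ.* r
  middle-bound s s′ = begin
    2 ℕ.* D + α′ + μ                            ≡⟨ lhs D α′ μ ⟩
    D + (D + α′) + μ                            ≤⟨ ℕ.+-monoˡ-≤ μ (ℕ.+-mono-≤
      (extendFromCentre partner (append legᵥ (reverse (Graph.sym G) partnerLeg)))
      (extendPruned s′ far₂≢far₁ (append far₂Leg (reverse (Graph.sym G) far₁Leg)))) ⟩
    (r + (α + β)) + (r + (δ + γ)) + μ                         ≡⟨ rhs r μ α β γ δ ⟩
    (μ + α + β + γ + δ) + 2 ℕ.* r               ≤⟨ ℕ.+-monoˡ-≤ _ bound ⟩
    r + 2 ℕ.* r                                 ≡⟨⟩
    3 ℕ.* r                                     ∎
    where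
    open ℕ.≤-Reasoning
    open Split s
    α′ = Split.α s′

    lhs : ∀ D α μ → 2 ℕ.* D + α + μ ≡ D + (D + α) + μ
    lhs = solve-∀

    rhs : ∀ r μ α β γ δ → (r + (α + β)) + (r + (δ + γ)) + μ ≡ (μ + α + β + γ + δ) + 2 ℕ.* r
    rhs = solve-∀

  -- Twice `middle-bound` plus `distances-bound` for `s′`: the factor 2 makes `α′` cancel and leaves
  -- `2 μ` against `μ′`.
  7D≤10r : 7 ℕ.* D ℕ.≤ 10 ℕ.* r
  7D≤10r = ℕ.+-cancelʳ-≤ (2 ℕ.* α′ + μ′) _ _ (begin
    7 ℕ.* D + (2 ℕ.* α′ + μ′)                   ≤⟨ ℕ.+-monoʳ-≤ (7 ℕ.* D)
      (ℕ.+-monoʳ-≤ (2 ℕ.* α′) (ℕ.≤-trans μ′≤μ (ℕ.m≤m+n μ (μ + 0)))) ⟩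
    7 ℕ.* D + (2 ℕ.* α′ + 2 ℕ.* μ)              ≡⟨ lhs D α′ μ ⟩
    2 ℕ.* (2 ℕ.* D + α′ + μ) + 3 ℕ.* D          ≤⟨ ℕ.+-mono-≤
      (ℕ.*-monoʳ-≤ 2 (middle-bound s s′)) (distances-bound s′) ⟩
    2 ℕ.* (3 ℕ.* r) + (4 ℕ.* r + 2 ℕ.* α′ + μ′) ≡⟨ rhs r α′ μ′ ⟩
    10 ℕ.* r + (2 ℕ.* α′ + μ′)                  ∎)
    where
    open ℕ.≤-Reasoning
    open Extrema ℕ.≤-totalOrder using (argmax; f[xs]≤f[argmax])

    middleLength : Fin 4 → ℕ
    middleLength i = Split.μ (split i)

    -- The default `zero` is harmless, since `allFin 4` contains every index.
    s  = split (argmax middleLength zero (allFin 4))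
    s′ = split (Split.far₁ s)
    μ  = Split.μ s
    μ′ = Split.μ s′
    α′ = Split.α s′

    μ′≤μ : μ′ ℕ.≤ μ
    μ′≤μ = All.lookup (f[xs]≤f[argmax] {f = middleLength} zero (allFin 4)) (∈-allFin (Split.far₁ s))

    lhs : ∀ D α μ → 7 ℕ.* D + (2 ℕ.* α + 2 ℕ.* μ) ≡ 2 ℕ.* (2 ℕ.* D + α + μ) + 3 ℕ.* D
    lhs = solve-∀

    rhs : ∀ r α μ → 2 ℕ.* (3 ℕ.* r) + (4 ℕ.* r + 2 ℕ.* α + μ) ≡ 10 ℕ.* r + (2 ℕ.* α + μ)
    rhs = solve-∀

-- Passage to rationals and conclusion

7d≤10r⇒d≤10/7*r : ∀ {d r} → 7 ℕ.* d ℕ.≤ 10 ℕ.* r → (+ d) / 1 ≤ ((+ 10) / 7) * ((+ r) / 1)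
7d≤10r⇒d≤10/7*r {d} {r} 7d≤10r = ℚ.toℚᵘ-cancel-≤ (begin
  ℚ.toℚᵘ ((+ d) / 1)                            ≃⟨ ℚ.toℚᵘ-fromℚᵘ (mkℚᵘ (+ d) 0) ⟩
  mkℚᵘ (+ d) 0                                  ≤⟨ *≤* (subst₂ ℤ._≤_
    (ℤ.pos-* d 7) (trans (ℤ.pos-* 10 r) (sym (ℤ.*-identityʳ _)))
    (+≤+ (subst (ℕ._≤ 10 ℕ.* r) (ℕ.*-comm 7 d) 7d≤10r))) ⟩
  -- `mkℚᵘ` takes the denominator minus one, so the factors are 10/7 and `r`.
  mkℚᵘ (+ 10) 6 ℚᵘ.* mkℚᵘ (+ r) 0               ≃⟨ ℚᵘ.*-congˡ {mkℚᵘ (+ 10) 6}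
    (ℚ.toℚᵘ-fromℚᵘ (mkℚᵘ (+ r) 0)) ⟨
  mkℚᵘ (+ 10) 6 ℚᵘ.* ℚ.toℚᵘ ((+ r) / 1)         ≃⟨ ℚ.toℚᵘ-homo-* ((+ 10) / 7) ((+ r) / 1) ⟨
  ℚ.toℚᵘ (((+ 10) / 7) * ((+ r) / 1))           ∎)
  where open ℚᵘ.≤-Reasoning

mainTheorem3 : ∀ (n : ℕ) → 4 ℕ.≤ n → (G : Graph n) → Connected G →
    ∀ (d r : ℕ) → IsSteinerDiameter G 4 d → IsSteinerRadius G 4 r →
    (+ d) / 1 ≤ ((+ 10) / 7) * ((+ r) / 1)
mainTheorem3 n 4≤n G conn d r ((_ , (S , ∣S∣≡4 , _ , S-distance) , _) , _) ((v , v-ecc) , _)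
  with t , t∈S , t-injective , t-surjective ← subst (λ k → ∃ λ (t : Fin k → Fin n) →
         (∀ i → t i ∈ₛ S) × (∀ {i j} → t i ≡ t j → i ≡ j) × (∀ {x} → x ∈ₛ S → ∃ λ i → x ≡ t i))
         ∣S∣≡4 (enumerate S) =
  -- The four trees exist only up to double negation; finitely many such statements combine, and
  -- decidability of the goal removes the negation.
  7d≤10r⇒d≤10/7*r {d} {r} (decidable-stable (7 ℕ.* d ℕ.≤? 10 ℕ.* r)
    (¬¬-map (7D≤10r lower) (Fin.sequence (RawMonad.rawApplicative ¬¬-Monad) tree)))
  where
  lower : ∀ {xs k} → Connects G xs k → (∀ j → t j ∈ xs) → d ℕ.≤ k
  lower c t⊆xs = steinerDistance≤ G S-distance c λ x∈S → let j , x≡tj = t-surjective x∈S in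
    subst (_∈ _) (sym x≡tj) (t⊆xs j)

  tree : ∀ i → ¬ ¬ Connects G (v ∷ map (t ∘ punchIn i) (allFin 3)) r
  -- The eccentricity of `v` is applied to `S` with `t i` exchanged for `v`.
  tree i = eccentricity-connects G conn v-ecc 4≤n
    (ℕ.≤-trans (∣p-x∪⁅y⁆∣≤∣p∣ (t∈S i) v) (ℕ.≤-reflexive ∣S∣≡4)) v∈
    (v∈ ∷ kept _ ∷ kept _ ∷ kept _ ∷ [])
    where
    v∈ : v ∈ₛ (S - t i) ∪ ⁅ v ⁆
    v∈ = Subset.x∈p∪q⁺ (inj₂ (Subset.x∈⁅x⁆ v))

    kept : ∀ c → t (punchIn i c) ∈ₛ (S - t i) ∪ ⁅ v ⁆
    kept c = Subset.x∈p∪q⁺ (inj₁ (Subset.x∈p∧x≢y⇒x∈p-y (t∈S _) (Fin.punchInᵢ≢i i c ∘ t-injective)))
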